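{- For every integer $n\geq 1$, the polynomial $P_n(x)$ is $\gamma$-positive, and so it is unimodal with mode in the middle (i.e. the index $n-1$ is a mode of $P_n(x)$, which is symmetric of degree $2n-2$).
   Context: Let $\mathcal{C}_n$ be the set of permutations (rearrangements) $\sigma=\sigma_1\cdots\sigma_{2n}$ of the multiset $\{1,1,2,2,\ldots,n,n\}$. For $\sigma\in\mathcal{C}_n$, $\mathrm{des}(\sigma)=\#\{i\in\{1,\ldots,2n-1\}:\sigma_i>\sigma_{i+1}\}$, and $P_n(x)=\sum_{\sigma\in\mathcal{C}_n}x^{\mathrm{des}(\sigma)}$. A polynomial $f(x)=\sum_{i=0}^d f_ix^i$ of degree $d$ is symmetric if $f_i=f_{d-i}$ for all $i$; it can then be written uniquely as $f(x)=\sum_{k=0}^{\lfloor d/2\rfloor}\gamma_kx^k(1+x)^{d-2k}$, and it is $\gamma$-positive if all $\gamma_k\geq 0$. It is unimodal with mode $m$ if $f_0\leq\cdots\leq f_m\geq\cdots\geq f_d$. -}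

module Defs where

open import Data.Bool using (if_then_else_)
open import Data.Integer as ℤ using (ℤ; 0ℤ; 1ℤ)
open import Data.List using (List; []; _∷_; _++_; map; foldr; filter; concatMap; upTo; length; cartesianProductWith)
open import Data.List.Membership.Propositional using (_∈_)
open import Data.List.Membership.Propositional.Properties using (∈-∃++; ∈-filter⁺; ∈-filter⁻; ∈-cartesianProductWith⁺)
open import Data.List.Properties using (∷-injective; length-map; length-upTo)
open import Data.List.Relation.Binary.Permutation.Propositional using (_↭_; ↭-refl; ↭-sym; ↭-trans; ↭-prep)
open import Data.List.Relation.Binary.Permutation.Propositional.Properties using (∈-resp-↭; ↭-empty-inv; ↭-length; shift; drop-∷)
open import Data.List.Relation.Unary.All using (All; []; _∷_)
import Data.List.Relation.Unary.All as All
open import Data.List.Relation.Unary.AllPairs using ([]; _∷_)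
open import Data.List.Relation.Unary.Any using (here; there)
open import Data.List.Relation.Unary.Unique.Propositional using (Unique)
import Data.List.Relation.Unary.Unique.Propositional.Properties as Unique
open import Data.Nat using (ℕ; zero; suc; _+_; _*_; _∸_; _≤_; _<_; _<?_; ⌊_/2⌋)
open import Data.Nat.Properties using (_≟_; suc-injective; *-suc)
open import Data.List.Membership.DecPropositional _≟_ using (_∈?_)
open import Data.Product using (Σ-syntax; _×_; _,_; proj₂)
open import Function using (_⇔_; mk⇔)
open import Relation.Binary.PropositionalEquality using (_≡_; _≢_; refl; sym; trans; cong; subst)
open import Relation.Nullary using (Dec; yes; no; does; contradiction)

letters : ℕ → List ℕ
letters n = map suc (upTo n)

twice : List ℕ → List ℕ
twice = concatMap (λ a → a ∷ a ∷ [])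

multiset : ℕ → List ℕ
multiset n = twice (letters n)

words : List ℕ → ℕ → List (List ℕ)
words as zero    = [] ∷ []
words as (suc m) = cartesianProductWith _∷_ as (words as m)

infix 4 _↭?_

_↭?_ : (xs ys : List ℕ) → Dec (xs ↭ ys)
[] ↭? [] = yes ↭-refl
[] ↭? (y ∷ ys) = no λ p → contradiction (↭-empty-inv (↭-sym p)) λ ()
(x ∷ xs) ↭? ys with x ∈? ys
... | no x∉ys = no λ p → x∉ys (∈-resp-↭ p (here refl))
... | yes x∈ys with ∈-∃++ x∈ys
...   | us , vs , refl with xs ↭? (us ++ vs)
...     | yes p = yes (↭-trans (↭-prep x p) (↭-sym (shift x us vs)))
...     | no ¬p = no λ p → ¬p (drop-∷ (↭-trans p (shift x us vs)))

-- The set 𝒞ₙ, as a list without repetitions; see ∈-𝒞 and 𝒞-unique.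
𝒞 : ℕ → List (List ℕ)
𝒞 n = filter (_↭? multiset n) (words (letters n) (2 * n))

private
  ∈-words : ∀ {as} w → All (_∈ as) w → w ∈ words as (length w)
  ∈-words []      []         = here refl
  ∈-words (a ∷ w) (a∈ ∷ w∈) = ∈-cartesianProductWith⁺ _∷_ a∈ (∈-words w w∈)

  length-twice : ∀ as → length (twice as) ≡ 2 * length as
  length-twice []       = refl
  length-twice (a ∷ as) =
    trans (cong (λ k → suc (suc k)) (length-twice as)) (sym (*-suc 2 (length as)))

  length-letters : ∀ n → length (letters n) ≡ n
  length-letters n = trans (length-map suc (upTo n)) (length-upTo n)

  ∈-twice : ∀ {a} as → a ∈ twice as → a ∈ as
  ∈-twice (b ∷ as) (here p)          = here p
  ∈-twice (b ∷ as) (there (here p))  = here p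
  ∈-twice (b ∷ as) (there (there p)) = there (∈-twice as p)

  words-unique : ∀ {as} m → Unique as → Unique (words as m)
  words-unique zero    u = [] ∷ []
  words-unique (suc m) u =
    Unique.cartesianProductWith⁺ _∷_ ∷-injective u (words-unique m u)

∈-𝒞 : ∀ n σ → σ ∈ 𝒞 n ⇔ (σ ↭ multiset n)
∈-𝒞 n σ = mk⇔ (λ σ∈ → proj₂ (∈-filter⁻ (_↭? multiset n) {xs = words (letters n) (2 * n)} σ∈)) from
  where
  from : σ ↭ multiset n → σ ∈ 𝒞 n
  from p = ∈-filter⁺ (_↭? multiset n) (subst (λ m → σ ∈ words (letters n) m) len mem) p
    where
    len : length σ ≡ 2 * n
    len = trans (↭-length p)
      (trans (length-twice (letters n)) (cong (2 *_) (length-letters n)))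
    mem : σ ∈ words (letters n) (length σ)
    mem = ∈-words σ (All.tabulate λ a∈σ → ∈-twice (letters n) (∈-resp-↭ p a∈σ))

𝒞-unique : ∀ n → Unique (𝒞 n)
𝒞-unique n = Unique.filter⁺ (_↭? multiset n)
  (words-unique (2 * n) (Unique.map⁺ suc-injective (Unique.upTo⁺ n)))

des : List ℕ → ℕ
des []          = 0
des (a ∷ [])    = 0
des (a ∷ b ∷ w) = (if does (b <? a) then 1 else 0) + des (b ∷ w)

-- Coefficient lists, constant term first; trailing zeros are allowed, so
-- equality of polynomials is _≈ₚ_ and not _≡_.
Poly : Set
Poly = List ℤ

coeff : Poly → ℕ → ℤ
coeff []      i       = 0ℤ
coeff (a ∷ f) zero    = a
coeff (a ∷ f) (suc i) = coeff f i

infix  4 _≈ₚ_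
infixl 6 _+ₚ_
infixl 7 _*ₚ_
infixr 7 _·ₚ_
infixr 8 _^ₚ_

_≈ₚ_ : Poly → Poly → Set
f ≈ₚ g = ∀ i → coeff f i ≡ coeff g i

_+ₚ_ : Poly → Poly → Poly
[]      +ₚ g       = g
(a ∷ f) +ₚ []      = a ∷ f
(a ∷ f) +ₚ (b ∷ g) = (a ℤ.+ b) ∷ (f +ₚ g)

_·ₚ_ : ℤ → Poly → Poly
c ·ₚ f = map (c ℤ.*_) f

_*ₚ_ : Poly → Poly → Poly
[]      *ₚ g = []
(a ∷ f) *ₚ g = a ·ₚ g +ₚ (0ℤ ∷ (f *ₚ g))

1ₚ X : Poly
1ₚ = 1ℤ ∷ []
X  = 0ℤ ∷ 1ℤ ∷ []

_^ₚ_ : Poly → ℕ → Poly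
f ^ₚ zero  = 1ₚ
f ^ₚ suc k = f *ₚ (f ^ₚ k)

sumₚ : List Poly → Poly
sumₚ = foldr _+ₚ_ []

HasDegree : Poly → ℕ → Set
HasDegree f d = coeff f d ≢ 0ℤ × (∀ i → d < i → coeff f i ≡ 0ℤ)

Symmetric : Poly → ℕ → Set
Symmetric f d = HasDegree f d × (∀ i → i ≤ d → coeff f i ≡ coeff f (d ∸ i))

-- Only γ 0, …, γ ⌊ d /2⌋ are used.
γ-expansion : ℕ → (ℕ → ℤ) → Poly
γ-expansion d γ =
  sumₚ (map (λ k → γ k ·ₚ (X ^ₚ k *ₚ (1ₚ +ₚ X) ^ₚ (d ∸ 2 * k))) (upTo (suc ⌊ d /2⌋)))

-- The coefficients γ k of a symmetric f are unique, and they are integers since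
-- f has integer coefficients and the expansion is unitriangular.
γ-Positive : Poly → Set
γ-Positive f = Σ[ d ∈ ℕ ] Symmetric f d ×
  (Σ[ γ ∈ (ℕ → ℤ) ] f ≈ₚ γ-expansion d γ × (∀ k → k ≤ ⌊ d /2⌋ → 0ℤ ℤ.≤ γ k))

UnimodalWithMode : Poly → ℕ → Set
UnimodalWithMode f m = Σ[ d ∈ ℕ ] HasDegree f d × m ≤ d ×
  (∀ i → i < m → coeff f i ℤ.≤ coeff f (suc i)) ×
  (∀ i → m ≤ i → i < d → coeff f (suc i) ℤ.≤ coeff f i)

P : ℕ → Poly
P n = sumₚ (map (λ σ → X ^ₚ des σ) (𝒞 n))

{-# OPTIONS --safe #-}
-- Let d and u = 2n − d be the numbers of descents and weak ascents of 0σ, for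
-- σ ∈ 𝒞ₙ, and let Fₙ(x, y) = Σ x^d y^(u−2) be the homogenisation of Pₙ.  Inserting
-- two letters n+1 into σ, each either in one of the d + 1 places that do not create
-- a descent or in one of the u places that do, gives
--   Fₙ₊₁ = ½ (∂x + ∂y)² (x²y² Fₙ).
-- The derivation ∂x + ∂y maps xy to x + y and x + y to 2, so it preserves the
-- polynomials in xy and x + y with nonnegative coefficients, and F₁ = 1.
-- Symmetry and unimodality hold for each (xy)^k (x + y)^(2j) with k + j = n − 1 and
-- pass to nonnegative combinations.
module Submission where

open import Defs
open import Data.Bool using (Bool; true; false; if_then_else_)
open import Data.Empty using (⊥)
open import Data.Integer as ℤ using (+_; 0ℤ; 1ℤ)
import Data.Integer.Properties as ℤ
open import Data.List using (List; []; _∷_; _++_; map; filter; length; concatMap; replicate; applyUpTo; upTo)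
open import Data.List.Membership.Propositional using (_∈_; find; lose)
open import Data.List.Membership.Propositional.Properties using (∈-map⁺; ∈-map⁻; ∈-++⁺ˡ; ∈-++⁺ʳ; ∈-++⁻; ∈-concatMap⁺; ∈-concatMap⁻)
open import Data.List.Membership.Propositional.Properties.WithK using (unique∧set⇒bag)
open import Data.List.Properties using (map-∘; map-++; map-cong; map-cong-local; map-upTo; upTo-∷ʳ; concatMap-++; filter-all; filter-none; filter-accept; filter-reject)
open import Data.List.Relation.Binary.BagAndSetEquality using (∼bag⇒↭)
open import Data.List.Relation.Binary.Permutation.Propositional using (_↭_; ↭-refl; ↭-sym; ↭-trans; ↭-prep; ↭-reflexive)
open import Data.List.Relation.Binary.Permutation.Propositional.Properties using (All-resp-↭; ↭-length; filter-↭; map⁺; ++-comm) renaming (shift to ↭-shift)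
open import Data.List.Relation.Unary.All as All using (All; []; _∷_)
import Data.List.Relation.Unary.All.Properties as All
open import Data.List.Relation.Unary.AllPairs using ([]; _∷_)
open import Data.List.Relation.Unary.Any using (here)
open import Data.List.Relation.Unary.Unique.Propositional using (Unique)
import Data.List.Relation.Unary.Unique.Propositional.Properties as Unique
open import Data.Nat using (ℕ; zero; suc; pred; _+_; _*_; _∸_; _≤_; _<_; _<?_; z≤n; s≤s; ⌊_/2⌋)
open import Data.Nat.ListAction using (sum)
open import Data.Nat.ListAction.Properties using (sum-++; sum-↭)
open import Data.Nat.Properties
open import Algebra.Properties.CommutativeSemigroup +-commutativeSemigroup using (interchange)
open import Data.Nat.Tactic.RingSolver using (solve-∀)
open import Data.Product using (Σ-syntax; _×_; _,_)
open import Data.Sum using (_⊎_; inj₁; inj₂)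
open import Function using (mk⇔; Equivalence)
open import Relation.Binary.PropositionalEquality using (_≡_; _≢_; refl; sym; trans; cong; cong₂; subst; subst₂; module ≡-Reasoning)
open import Relation.Nullary using (Dec; does; yes; no; ¬?)
open import Relation.Nullary.Decidable using (dec-true; dec-false)

-- Functionals on weights

-- A weight φ assigns a value to each monomial x^a y^b; a homogeneous polynomial
-- acts on weights by linear extension.
Weight : Set
Weight = ℕ → ℕ → ℕ

-- L e φ a b is the value of φ on x^a y^b (x + y)^e.
L : ℕ → Weight → Weight
L zero    φ a b = φ a b
L (suc e) φ a b = L e φ (suc a) b + L e φ a (suc b)

-- (x + y)^e is homogeneous, so only the values of φ in total degree a + b + e matter.
L-cong : ∀ e {φ ψ : Weight} a b → (∀ a′ b′ → a′ + b′ ≡ a + b + e → φ a′ b′ ≡ ψ a′ b′) →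
  L e φ a b ≡ L e ψ a b
L-cong zero    a b eq = eq a b (sym (+-identityʳ (a + b)))
L-cong (suc e) a b eq = cong₂ _+_
  (L-cong e (suc a) b λ a′ b′ p → eq a′ b′ (trans p (sym (+-suc (a + b) e))))
  (L-cong e a (suc b) λ a′ b′ p → eq a′ b′ (trans p
    (trans (cong (_+ e) (+-suc a b)) (sym (+-suc (a + b) e)))))

L-+ : ∀ e φ ψ a b → L e (λ a b → φ a b + ψ a b) a b ≡ L e φ a b + L e ψ a b
L-+ zero    φ ψ a b = refl
L-+ (suc e) φ ψ a b = trans
  (cong₂ _+_ (L-+ e φ ψ (suc a) b) (L-+ e φ ψ a (suc b)))
  (interchange (L e φ (suc a) b) _ _ _)

L-* : ∀ e c φ a b → L e (λ a b → c * φ a b) a b ≡ c * L e φ a b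
L-* zero    c φ a b = refl
L-* (suc e) c φ a b = trans
  (cong₂ _+_ (L-* e c φ (suc a) b) (L-* e c φ a (suc b)))
  (sym (*-distribˡ-+ c _ _))

L-suc : ∀ e φ a b → L (suc e) φ a b ≡ L e (λ a b → φ (suc a) b + φ a (suc b)) a b
L-suc zero    φ a b = refl
L-suc (suc e) φ a b = cong₂ _+_ (L-suc e φ (suc a) b) (L-suc e φ a (suc b))

L-swap : ∀ e φ a b → L e φ a b ≡ L e (λ a b → φ b a) b a
L-swap zero    φ a b = refl
L-swap (suc e) φ a b = trans
  (cong₂ _+_ (L-swap e φ (suc a) b) (L-swap e φ a (suc b)))
  (+-comm (L e (λ a b → φ b a) b (suc a)) _)

shift : Weight → Weight
shift φ a b = φ (2 + a) (2 + b)

L-shift : ∀ e φ a b → L e (shift φ) a b ≡ L e φ (2 + a) (2 + b)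
L-shift zero    φ a b = refl
L-shift (suc e) φ a b = cong₂ _+_ (L-shift e φ (suc a) b) (L-shift e φ a (suc b))

-- The adjoint of ∂x + ∂y.
D : Weight → Weight
D φ a b = a * φ (pred a) b + b * φ a (pred b)

-- The factor n hides the truncation of `pred` at 0.
*-suc-pred : ∀ (f : ℕ → ℕ) n → n * f (suc (pred n)) ≡ n * f n
*-suc-pred f zero    = refl
*-suc-pred f (suc n) = refl

-- The Leibniz rule for x^a y^b (x + y)^e, where ∂x + ∂y sends x + y to 2.
L-D : ∀ e φ a b → L e (D φ) a b ≡
  a * L e φ (pred a) b + b * L e φ a (pred b) + 2 * (e * L (pred e) φ a b)
L-D zero    φ a b = sym (+-identityʳ _)
L-D (suc e) φ a b = begin
  L e (D φ) (suc a) b + L e (D φ) a (suc b)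
    ≡⟨ cong₂ _+_ (L-D e φ (suc a) b) (L-D e φ a (suc b)) ⟩
  (suc a * ab + b * L e φ (suc a) (pred b) + 2 * (e * L (pred e) φ (suc a) b)) +
  (a * L e φ (pred a) (suc b) + suc b * ab + 2 * (e * L (pred e) φ a (suc b)))
    ≡⟨ regroup a b e ab _ _ _ _ ⟩
  (a * ab + a * L e φ (pred a) (suc b)) + (b * L e φ (suc a) (pred b) + b * ab) +
  2 * (ab + e * L (suc (pred e)) φ a b)
    ≡⟨ cong₂ _+_ (cong₂ _+_
         (cong (_+ a * L e φ (pred a) (suc b)) (*-suc-pred (λ x → L e φ x b) a))
         (cong (_+_ (b * L e φ (suc a) (pred b))) (*-suc-pred (λ x → L e φ a x) b)))
         (cong (λ x → 2 * (ab + x)) (sym (*-suc-pred (λ x → L x φ a b) e))) ⟨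
  (a * L e φ (suc (pred a)) b + a * L e φ (pred a) (suc b)) +
  (b * L e φ (suc a) (pred b) + b * L e φ a (suc (pred b))) +
  2 * (suc e * ab)
    ≡⟨ cong (_+ 2 * (suc e * ab)) (cong₂ _+_
         (*-distribˡ-+ a (L e φ (suc (pred a)) b) _) (*-distribˡ-+ b (L e φ (suc a) (pred b)) _)) ⟨
  a * L (suc e) φ (pred a) b + b * L (suc e) φ a (pred b) + 2 * (suc e * ab) ∎
  where
  open ≡-Reasoning
  ab = L e φ a b
  regroup : ∀ a b e x p q r s →
    (suc a * x + b * p + 2 * (e * q)) + (a * r + suc b * x + 2 * (e * s)) ≡
    (a * x + a * r) + (b * p + b * x) + 2 * (x + e * (q + s))
  regroup = solve-∀

-- The derivation sends xy to x + y and x + y to 2, hence stays in the algebra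
-- generated by the two.
L-D-diag : ∀ e φ a → L e (D φ) (suc a) (suc a) ≡
  suc a * L (suc e) φ a a + 2 * (e * L (pred e) φ (suc a) (suc a))
L-D-diag e φ a = trans (L-D e φ (suc a) (suc a))
  (cong (_+ 2 * (e * L (pred e) φ (suc a) (suc a)))
    (trans (sym (*-distribˡ-+ (suc a) (L e φ a (suc a)) _))
      (cong (suc a *_) (+-comm (L e φ a (suc a)) _))))

-- The binomial coefficient n choose 2; it keeps half of a second derivative within ℕ.
tri : ℕ → ℕ
tri zero    = 0
tri (suc n) = n + tri n

2*tri : ∀ n → 2 * tri n ≡ n * pred n
2*tri zero          = refl
2*tri (suc zero)    = refl
2*tri (suc (suc n)) = trans (*-distribˡ-+ 2 (suc n) _)
  (trans (cong (_+_ (2 * suc n)) (2*tri (suc n))) (eq n))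
  where
  eq : ∀ n → 2 * suc n + suc n * n ≡ suc (suc n) * suc n
  eq = solve-∀

-- The adjoint of (∂x + ∂y)² / 2.
T : Weight → Weight
T φ a b = tri a * φ (pred (pred a)) b + a * b * φ (pred a) (pred b) + tri b * φ a (pred (pred b))

2*T≡D² : ∀ φ a b → 2 * T φ a b ≡ D (D φ) a b
2*T≡D² φ a b = begin
  2 * (tri a * p + a * b * q + tri b * r)
    ≡⟨ expand (tri a) (tri b) (a * b) p q r ⟩
  2 * tri a * p + 2 * (a * b * q) + 2 * tri b * r
    ≡⟨ cong₂ (λ s t → s * p + 2 * (a * b * q) + t * r) (2*tri a) (2*tri b) ⟩
  a * pred a * p + 2 * (a * b * q) + b * pred b * r
    ≡⟨ collect a b (pred a) (pred b) p q r ⟩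
  D (D φ) a b ∎
  where
  open ≡-Reasoning
  p = φ (pred (pred a)) b
  q = φ (pred a) (pred b)
  r = φ a (pred (pred b))
  expand : ∀ s t u p q r → 2 * (s * p + u * q + t * r) ≡ 2 * s * p + 2 * (u * q) + 2 * t * r
  expand = solve-∀
  collect : ∀ a b a′ b′ p q r → a * a′ * p + 2 * (a * b * q) + b * b′ * r ≡
    a * (a′ * p + b * q) + b * (a * q + b′ * r)
  collect = solve-∀

-- The rule for `D` on diagonal monomials yields diagonal terms again, so it applies twice; `T` is
-- half of the result, whence the cancelled factor 2.
L-T-diag : ∀ e φ k → L e (T φ) (2 + k) (2 + k) ≡
  tri (2 + k) * L (2 + e) φ k k + (2 + k) * (1 + 2 * e) * L e φ (1 + k) (1 + k) +
  2 * (e * pred e) * L (pred (pred e)) φ (2 + k) (2 + k)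
L-T-diag e φ k = *-cancelˡ-≡ _ _ 2 (begin
  2 * L e (T φ) (2 + k) (2 + k)
    ≡⟨ L-* e 2 (T φ) (2 + k) (2 + k) ⟨
  L e (λ a b → 2 * T φ a b) (2 + k) (2 + k)
    ≡⟨ L-cong e (2 + k) (2 + k) (λ a b _ → 2*T≡D² φ a b) ⟩
  L e (D (D φ)) (2 + k) (2 + k)
    ≡⟨ L-D-diag e (D φ) (1 + k) ⟩
  (2 + k) * L (1 + e) (D φ) (1 + k) (1 + k) + 2 * (e * L (pred e) (D φ) (2 + k) (2 + k))
    ≡⟨ cong₂ (λ s t → (2 + k) * s + 2 * t) (L-D-diag (1 + e) φ k) (second e) ⟩
  (2 + k) * ((1 + k) * x + 2 * ((1 + e) * y)) + 2 * (e * ((2 + k) * y + 2 * (pred e * z)))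
    ≡⟨ collect k e (pred e) x y z ⟩
  (2 + k) * (1 + k) * x + 2 * ((2 + k) * (1 + 2 * e) * y) + 2 * (2 * (e * pred e) * z)
    ≡⟨ cong (λ t → t * x + 2 * ((2 + k) * (1 + 2 * e) * y) + 2 * (2 * (e * pred e) * z)) (2*tri (2 + k)) ⟨
  2 * tri (2 + k) * x + 2 * ((2 + k) * (1 + 2 * e) * y) + 2 * (2 * (e * pred e) * z)
    ≡⟨ factor (tri (2 + k)) x _ _ ⟩
  2 * (tri (2 + k) * x + (2 + k) * (1 + 2 * e) * y + 2 * (e * pred e) * z) ∎)
  where
  open ≡-Reasoning
  x = L (2 + e) φ k k
  y = L e φ (1 + k) (1 + k)
  z = L (pred (pred e)) φ (2 + k) (2 + k)
  -- The rule at exponent `pred e` produces the exponent `suc (pred e)`, which is e unless e = 0,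
  -- where the factor e vanishes.
  second : ∀ e → e * L (pred e) (D φ) (2 + k) (2 + k) ≡
    e * ((2 + k) * L e φ (1 + k) (1 + k) + 2 * (pred e * L (pred (pred e)) φ (2 + k) (2 + k)))
  second zero    = refl
  second (suc e) = cong (suc e *_) (L-D-diag e φ (1 + k))
  collect : ∀ k e e′ x y z →
    (2 + k) * ((1 + k) * x + 2 * ((1 + e) * y)) + 2 * (e * ((2 + k) * y + 2 * (e′ * z))) ≡
    (2 + k) * (1 + k) * x + 2 * ((2 + k) * (1 + 2 * e) * y) + 2 * (2 * (e * e′) * z)
  collect = solve-∀
  factor : ∀ t x p q → 2 * t * x + 2 * p + 2 * q ≡ 2 * (t * x + p + q)
  factor = solve-∀

-- The cone of gamma-positive forms

Functional : Set
Functional = Weight → ℕ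

-- The functionals given by nonnegative combinations of the polynomials
-- (xy)^k (x + y)^(2j) of degree 2N.
data Cone (N : ℕ) : Functional → Set where
  basis : ∀ k j → k + j ≡ N → Cone N (λ φ → L (2 * j) φ k k)
  null  : Cone N (λ _ → 0)
  plus  : ∀ {Φ Ψ} → Cone N Φ → Cone N Ψ → Cone N (λ φ → Φ φ + Ψ φ)
  ext   : ∀ {Φ Ψ} → (∀ φ → Φ φ ≡ Ψ φ) → Cone N Φ → Cone N Ψ

scale : ∀ {N Φ} c → Cone N Φ → Cone N (λ φ → c * Φ φ)
scale zero    p = null
scale (suc c) p = plus p (scale c p)

-- The adjoint form of f ↦ ½ (∂x + ∂y)² (x²y² f).
Cone-T : ∀ {N Φ} → Cone N Φ → Cone (suc N) (λ φ → Φ (shift (T φ)))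
-- For j = 0 the term that would lower the exponent of x + y has coefficient 0 and is dropped.
Cone-T (basis k zero eq) = ext
  (λ φ → sym (trans (L-T-diag 0 φ k) (+-identityʳ _)))
  (plus (scale (tri (2 + k)) (basis k 1 (trans (+-suc k 0) (cong suc eq))))
        (scale ((2 + k) * 1) (basis (suc k) 0 (cong suc eq))))
Cone-T (basis k (suc j) eq) = ext
  (λ φ → sym (trans (L-shift (2 * suc j) (T φ) k k) (trans (L-T-diag (2 * suc j) φ k) (cong₂ (λ e e′ →
    tri (2 + k) * L e φ k k + (2 + k) * (1 + 2 * (2 * suc j)) * L (2 * suc j) φ (1 + k) (1 + k) +
      2 * ((2 * suc j) * pred (2 * suc j)) * L e′ φ (2 + k) (2 + k))
    (sym (*-suc 2 (suc j))) (cong (λ e → pred (pred e)) (*-suc 2 j))))))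
  (plus (plus (scale (tri (2 + k)) (basis k (2 + j) (trans (+-suc k (suc j)) (cong suc eq))))
              (scale ((2 + k) * (1 + 2 * (2 * suc j))) (basis (1 + k) (suc j) (cong suc eq))))
        (scale (2 * ((2 * suc j) * pred (2 * suc j))) (basis (2 + k) j
          (cong suc (trans (sym (+-suc k j)) eq)))))
Cone-T null       = null
Cone-T (plus p q) = plus (Cone-T p) (Cone-T q)
Cone-T (ext eq p) = ext (λ φ → eq (shift (T φ))) (Cone-T p)

-- F N is the homogenisation of P (suc N); see S≡F.
F : ℕ → Functional
F zero    φ = φ 0 0
F (suc N) φ = F N (shift (T φ))

F-Cone : ∀ N → Cone N (F N)
F-Cone zero    = basis 0 0 refl
F-Cone (suc N) = Cone-T (F-Cone N)

-- Every form in the cone is homogeneous of degree 2N. Hence a weight that tests only the exponent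
-- of x can be traded for one that tests both exponents.
Cone-cong : ∀ {N Φ} → Cone N Φ → ∀ {φ ψ : Weight} →
  (∀ a b → a + b ≡ 2 * N → φ a b ≡ ψ a b) → Φ φ ≡ Φ ψ
Cone-cong (basis k j refl) eq = L-cong (2 * j) k k λ a b p → eq a b (trans p (total k j))
  where
  total : ∀ k j → k + k + 2 * j ≡ 2 * (k + j)
  total = solve-∀
Cone-cong null        eq = refl
Cone-cong (plus p q)  eq = cong₂ _+_ (Cone-cong p eq) (Cone-cong q eq)
Cone-cong (ext e p) {φ} {ψ} eq = trans (sym (e φ)) (trans (Cone-cong p eq) (e ψ))

Cone-swap : ∀ {N Φ} → Cone N Φ → ∀ φ → Φ φ ≡ Φ (λ a b → φ b a)
Cone-swap (basis k j _) φ = L-swap (2 * j) φ k k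
Cone-swap null       φ = refl
Cone-swap (plus p q) φ = cong₂ _+_ (Cone-swap p φ) (Cone-swap q φ)
Cone-swap (ext e p)  φ = trans (sym (e φ)) (trans (Cone-swap p φ) (e _))

Cone-0 : ∀ {N Φ} → Cone N Φ → Φ (λ _ _ → 0) ≡ 0
Cone-0 (basis k j _) = L-* (2 * j) 0 (λ _ _ → 0) k k
Cone-0 null       = refl
Cone-0 (plus p q) = cong₂ _+_ (Cone-0 p) (Cone-0 q)
Cone-0 (ext e p)  = trans (sym (e _)) (Cone-0 p)

-- Coefficient extraction and monotonicity

ind : ℕ → ℕ → ℕ
ind zero    zero    = 1
ind zero    (suc _) = 0
ind (suc _) zero    = 0
ind (suc m) (suc n) = ind m n

ind-≡ : ∀ m → ind m m ≡ 1
ind-≡ zero    = refl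
ind-≡ (suc m) = ind-≡ m

ind-< : ∀ {m n} → m < n → ind m n ≡ 0
ind-< {zero}  (s≤s _) = refl
ind-< {suc m} (s≤s p) = ind-< p

-- As a weight this reads off the coefficient of x^p y^q.
χ : ℕ → ℕ → Weight
χ p q a b = ind a p * ind b q

-- In total degree p + q the exponent of x determines that of y.
ind≡χ : ∀ a b p q → a + b ≡ p + q → ind a p ≡ χ p q a b
ind≡χ zero    b zero    .b refl = sym (trans (+-identityʳ (ind b b)) (ind-≡ b))
ind≡χ zero    b (suc p) q  _    = refl
ind≡χ (suc a) b zero    q  _    = refl
ind≡χ (suc a) b (suc p) q  eq   = ind≡χ a b p q (suc-injective eq)

χ-diag : ∀ {p q} a → p ≤ q → χ p (suc q) a a ≡ 0
χ-diag {p} zero  p≤q = *-zeroʳ (ind 0 p)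
χ-diag {zero}  (suc a) p≤q = refl
χ-diag {suc p} (suc a) (s≤s p≤q) = χ-diag a p≤q

-- Pascal's rule: multiplication by x + y adds neighbouring coefficients.
L-χ-suc : ∀ e p q a b → L (suc e) (χ (suc p) (suc q)) a b ≡
  L e (χ p (suc q)) a b + L e (χ (suc p) q) a b
L-χ-suc e p q a b = trans (L-suc e (χ (suc p) (suc q)) a b) (L-+ e (χ p (suc q)) (χ (suc p) q) a b)

L-χ-suc₀ : ∀ e q a b → L (suc e) (χ 0 (suc q)) a b ≡ L e (χ 0 q) a b
L-χ-suc₀ e q a b = L-suc e (χ 0 (suc q)) a b

L-χ-swap : ∀ e p q a → L e (χ p q) a a ≡ L e (χ q p) a a
L-χ-swap e p q a = trans (L-swap e (χ p q) a a)
  (L-cong e a a λ a′ b′ _ → *-comm (ind b′ p) (ind a′ q))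

-- Induction on e. By Pascal's rule both sides share a middle term, and the outer terms remain to be
-- compared: off the centre by two uses of the induction hypothesis, at the centre by symmetry.
L-χ-mono : ∀ e {p q} a → p ≤ q → L e (χ p (suc q)) a a ≤ L e (χ (suc p) q) a a
L-χ-mono zero a p≤q = ≤-trans (≤-reflexive (χ-diag a p≤q)) z≤n
L-χ-mono (suc e) {zero} {zero}  a p≤q = ≤-reflexive (L-χ-swap (suc e) 0 1 a)
L-χ-mono (suc e) {zero} {suc q} a p≤q
  rewrite L-χ-suc₀ e (suc q) a a | L-χ-suc e 0 q a a = m≤m+n _ _
L-χ-mono (suc e) {suc p} {suc q} a (s≤s p≤q)
  rewrite L-χ-suc e p (suc q) a a | L-χ-suc e (suc p) q a a
        | +-comm (L e (χ p (2 + q)) a a) (L e (χ (suc p) (suc q)) a a)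
  = +-monoʳ-≤ _ (outer (m≤n⇒m<n∨m≡n p≤q))
  where
  outer : p < q ⊎ p ≡ q → L e (χ p (2 + q)) a a ≤ L e (χ (2 + p) q) a a
  outer (inj₁ p<q)  = ≤-trans (L-χ-mono e a (m≤n⇒m≤1+n p≤q)) (L-χ-mono e a p<q)
  outer (inj₂ refl) = ≤-reflexive (L-χ-swap e p (2 + p) a)

Cone-mono : ∀ {N Φ} → Cone N Φ → ∀ {p q} → p ≤ q → Φ (χ p (suc q)) ≤ Φ (χ (suc p) q)
Cone-mono (basis k j _) p≤q = L-χ-mono (2 * j) k p≤q
Cone-mono null       p≤q = z≤n
Cone-mono (plus p q) p≤q = +-mono-≤ (Cone-mono p p≤q) (Cone-mono q p≤q)
Cone-mono (ext e p)  p≤q = subst₂ _≤_ (e _) (e _) (Cone-mono p p≤q)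

T-mono : ∀ {φ ψ : Weight} → (∀ a b → φ a b ≤ ψ a b) → ∀ a b → T φ a b ≤ T ψ a b
T-mono h a b = +-mono-≤ (+-mono-≤ (*-monoʳ-≤ (tri a) (h _ _)) (*-monoʳ-≤ (a * b) (h _ _)))
  (*-monoʳ-≤ (tri b) (h _ _))

F-mono : ∀ N {φ ψ : Weight} → (∀ a b → φ a b ≤ ψ a b) → F N φ ≤ F N ψ
F-mono zero    h = h 0 0
F-mono (suc N) h = F-mono N λ a b → T-mono h (2 + a) (2 + b)

-- The constant coefficient is positive, which symmetry turns into a nonzero leading coefficient.
-- The step keeps one copy of the first summand of `T`.
F-const-pos : ∀ N → 1 ≤ F N (λ a _ → ind a 0)
F-const-pos zero    = ≤-refl
F-const-pos (suc N) = ≤-trans (F-const-pos N) (F-mono N λ a b →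
  ≤-trans (m≤m+n (ind a 0) _) (≤-trans (m≤m+n _ _) (m≤m+n _ _)))

-- Coefficients of polynomials

sum-applyUpTo-cong : ∀ {f g : ℕ → ℕ} → (∀ i → f i ≡ g i) →
  ∀ n → sum (applyUpTo f n) ≡ sum (applyUpTo g n)
sum-applyUpTo-cong eq zero    = refl
sum-applyUpTo-cong eq (suc n) = cong₂ _+_ (eq 0) (sum-applyUpTo-cong (λ i → eq (suc i)) n)

sum-applyUpTo-0 : ∀ n → sum (applyUpTo (λ _ → 0) n) ≡ 0
sum-applyUpTo-0 zero    = refl
sum-applyUpTo-0 (suc n) = sum-applyUpTo-0 n

sum-applyUpTo-+ : ∀ (f g : ℕ → ℕ) n →
  sum (applyUpTo (λ i → f i + g i) n) ≡ sum (applyUpTo f n) + sum (applyUpTo g n)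
sum-applyUpTo-+ f g zero    = refl
sum-applyUpTo-+ f g (suc n) = trans
  (cong (_+_ (f 0 + g 0)) (sum-applyUpTo-+ (λ i → f (suc i)) (λ i → g (suc i)) n))
  (interchange (f 0) _ _ _)

sum-applyUpTo-ind : ∀ {k n} (f : ℕ → ℕ) → k < n → sum (applyUpTo (λ i → ind k i * f i) n) ≡ f k
sum-applyUpTo-ind {zero}  {suc n} f _       = trans
  (cong₂ _+_ (*-identityˡ (f 0)) (sum-applyUpTo-0 n)) (+-identityʳ (f 0))
sum-applyUpTo-ind {suc k} {suc n} f (s≤s p) = sum-applyUpTo-ind (λ i → f (suc i)) p

-- Since k + j = N, the index k fixes the exponent 2j = 2N - 2k, so a combination is recorded by one
-- coefficient for each k.
Cone-γ : ∀ {N Φ} → Cone N Φ → Σ[ γ ∈ (ℕ → ℕ) ] (∀ φ →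
  Φ φ ≡ sum (applyUpTo (λ k → γ k * L (2 * N ∸ 2 * k) φ k k) (suc N)))
Cone-γ {N} (basis k j refl) = ind k , λ φ → sym (trans
  (sum-applyUpTo-ind (λ i → L (2 * N ∸ 2 * i) φ i i) (s≤s (m≤m+n k j)))
  (cong (λ e → L e φ k k) (trans (sym (*-distribˡ-∸ 2 (k + j) k)) (cong (2 *_) (m+n∸m≡n k j)))))
Cone-γ {N} null = (λ _ → 0) , λ φ → sym (sum-applyUpTo-0 N)
Cone-γ {N} (plus p q) with Cone-γ p | Cone-γ q
... | γ , eq | γ′ , eq′ = (λ k → γ k + γ′ k) , λ φ → trans (cong₂ _+_ (eq φ) (eq′ φ)) (trans
  (sym (sum-applyUpTo-+ (λ k → γ k * L (2 * N ∸ 2 * k) φ k k) (λ k → γ′ k * L (2 * N ∸ 2 * k) φ k k) (suc N)))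
  (sum-applyUpTo-cong (λ k → sym (*-distribʳ-+ (L (2 * N ∸ 2 * k) φ k k) (γ k) (γ′ k))) (suc N)))
Cone-γ (ext e p) with Cone-γ p
... | γ , eq = γ , λ φ → trans (sym (e φ)) (eq φ)

coeff-+ₚ : ∀ f g i → coeff (f +ₚ g) i ≡ coeff f i ℤ.+ coeff g i
coeff-+ₚ []      g       i       = sym (ℤ.+-identityˡ (coeff g i))
coeff-+ₚ (a ∷ f) []      i       = sym (ℤ.+-identityʳ (coeff (a ∷ f) i))
coeff-+ₚ (a ∷ f) (b ∷ g) zero    = refl
coeff-+ₚ (a ∷ f) (b ∷ g) (suc i) = coeff-+ₚ f g i

coeff-·ₚ : ∀ c f i → coeff (c ·ₚ f) i ≡ c ℤ.* coeff f i
coeff-·ₚ c []      i       = sym (ℤ.*-zeroʳ c)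
coeff-·ₚ c (a ∷ f) zero    = refl
coeff-·ₚ c (a ∷ f) (suc i) = coeff-·ₚ c f i

coeff-∷-*ₚ : ∀ a f g i → coeff ((a ∷ f) *ₚ g) i ≡ a ℤ.* coeff g i ℤ.+ coeff (0ℤ ∷ f *ₚ g) i
coeff-∷-*ₚ a f g i = trans (coeff-+ₚ (a ·ₚ g) (0ℤ ∷ f *ₚ g) i)
  (cong (ℤ._+ coeff (0ℤ ∷ f *ₚ g) i) (coeff-·ₚ a g i))

∷-cong : ∀ {a b f g} → a ≡ b → f ≈ₚ g → a ∷ f ≈ₚ b ∷ g
∷-cong eq eqs zero    = eq
∷-cong eq eqs (suc i) = eqs i

0≈0∷ : [] ≈ₚ 0ℤ ∷ []
0≈0∷ zero    = refl
0≈0∷ (suc i) = refl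

-- The zero polynomial may be a nonempty list of zeros, a case that the congruence of the product
-- for `_≈ₚ_` has to cover.
*ₚ-zeroˡ : ∀ f g → f ≈ₚ [] → f *ₚ g ≈ₚ []
*ₚ-zeroˡ []      g eq i = refl
*ₚ-zeroˡ (a ∷ f) g eq i = begin
  coeff ((a ∷ f) *ₚ g) i                       ≡⟨ coeff-∷-*ₚ a f g i ⟩
  a ℤ.* coeff g i ℤ.+ coeff (0ℤ ∷ f *ₚ g) i    ≡⟨ cong₂ (λ x y → x ℤ.* coeff g i ℤ.+ y) (eq 0)
                                                  (trans (∷-cong refl (*ₚ-zeroˡ f g λ i → eq (suc i)) i) (sym (0≈0∷ i))) ⟩
  0ℤ ℤ.* coeff g i ℤ.+ 0ℤ                      ≡⟨ ℤ.+-identityʳ _ ⟩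
  0ℤ ℤ.* coeff g i                             ≡⟨⟩
  0ℤ                                           ∎
  where open ≡-Reasoning

*ₚ-congʳ : ∀ {f f′} g → f ≈ₚ f′ → f *ₚ g ≈ₚ f′ *ₚ g
*ₚ-congʳ {[]}    {f′}     g eq i = sym (*ₚ-zeroˡ f′ g (λ j → sym (eq j)) i)
*ₚ-congʳ {a ∷ f} {[]}     g eq i = *ₚ-zeroˡ (a ∷ f) g eq i
*ₚ-congʳ {a ∷ f} {b ∷ f′} g eq i = trans (coeff-∷-*ₚ a f g i) (trans
  (cong₂ (λ x y → x ℤ.* coeff g i ℤ.+ y) (eq 0)
    (∷-cong {0ℤ} refl (*ₚ-congʳ {f} {f′} g λ j → eq (suc j)) i))
  (sym (coeff-∷-*ₚ b f′ g i)))

1ₚ-*ₚ : ∀ g → 1ₚ *ₚ g ≈ₚ g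
1ₚ-*ₚ g i = trans (coeff-∷-*ₚ 1ℤ [] g i)
  (trans (cong₂ ℤ._+_ (ℤ.*-identityˡ (coeff g i)) (sym (0≈0∷ i))) (ℤ.+-identityʳ _))

0∷-*ₚ : ∀ f g → (0ℤ ∷ f) *ₚ g ≈ₚ 0ℤ ∷ f *ₚ g
0∷-*ₚ f g i = trans (coeff-∷-*ₚ 0ℤ f g i) (ℤ.+-identityˡ _)

X-*ₚ : ∀ g → X *ₚ g ≈ₚ 0ℤ ∷ g
X-*ₚ g i = trans (0∷-*ₚ 1ₚ g i) (∷-cong refl (1ₚ-*ₚ g) i)

1+X-*ₚ : ∀ g i → coeff ((1ₚ +ₚ X) *ₚ g) i ≡ coeff g i ℤ.+ coeff (0ℤ ∷ g) i
1+X-*ₚ g i = trans (coeff-∷-*ₚ 1ℤ 1ₚ g i)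
  (cong₂ ℤ._+_ (ℤ.*-identityˡ (coeff g i)) (∷-cong {0ℤ} refl (1ₚ-*ₚ g) i))

coeff-X^ : ∀ k i → coeff (X ^ₚ k) i ≡ + ind k i
coeff-X^ zero    zero    = refl
coeff-X^ zero    (suc i) = refl
coeff-X^ (suc k) zero    = X-*ₚ (X ^ₚ k) 0
coeff-X^ (suc k) (suc i) = trans (X-*ₚ (X ^ₚ k) (suc i)) (coeff-X^ k i)

L-ind-suc-0 : ∀ e a b → L e (λ a _ → ind a 0) (suc a) b ≡ 0
L-ind-suc-0 zero    a b = refl
L-ind-suc-0 (suc e) a b = cong₂ _+_ (L-ind-suc-0 e (suc a) b) (L-ind-suc-0 e a (suc b))

-- The weight ignores the exponent of y, so b and b′ are free; this amounts to setting y = 1.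
L-ind-suc : ∀ e i a b b′ → L e (λ a _ → ind a (suc i)) (suc a) b ≡ L e (λ a _ → ind a i) a b′
L-ind-suc zero    i a b b′ = refl
L-ind-suc (suc e) i a b b′ = cong₂ _+_ (L-ind-suc e i (suc a) b b′) (L-ind-suc e i a (suc b) (suc b′))

coeff-[1+X]^ : ∀ e i b → coeff ((1ₚ +ₚ X) ^ₚ e) i ≡ + L e (λ a _ → ind a i) 0 b
coeff-[1+X]^ zero    zero    b = refl
coeff-[1+X]^ zero    (suc i) b = refl
coeff-[1+X]^ (suc e) zero    b = trans (1+X-*ₚ ((1ₚ +ₚ X) ^ₚ e) 0)
  (trans (ℤ.+-identityʳ _) (trans (coeff-[1+X]^ e 0 (suc b))
    (cong (λ x → + (x + L e (λ a _ → ind a 0) 0 (suc b))) (sym (L-ind-suc-0 e 0 b)))))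
coeff-[1+X]^ (suc e) (suc i) b = trans (1+X-*ₚ ((1ₚ +ₚ X) ^ₚ e) (suc i)) (trans
  (cong₂ ℤ._+_ (coeff-[1+X]^ e (suc i) (suc b)) (coeff-[1+X]^ e i b))
  (cong +_ (trans (+-comm (L e (λ a _ → ind a (suc i)) 0 (suc b)) _)
    (cong (_+ L e (λ a _ → ind a (suc i)) 0 (suc b)) (sym (L-ind-suc e i 0 b b))))))

-- Setting y = 1 turns x^k y^b (x + y)^e into x^k (1 + x)^e, whatever b is.
coeff-basis : ∀ k e i b → coeff (X ^ₚ k *ₚ (1ₚ +ₚ X) ^ₚ e) i ≡ + L e (λ a _ → ind a i) k b
coeff-basis zero    e i b = trans (1ₚ-*ₚ ((1ₚ +ₚ X) ^ₚ e) i) (coeff-[1+X]^ e i b)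
coeff-basis (suc k) e i b = trans
  (*ₚ-congʳ {X ^ₚ suc k} {0ℤ ∷ X ^ₚ k} ((1ₚ +ₚ X) ^ₚ e) (X-*ₚ (X ^ₚ k)) i)
  (trans (0∷-*ₚ (X ^ₚ k) ((1ₚ +ₚ X) ^ₚ e) i) (tail i))
  where
  tail : ∀ i → coeff (0ℤ ∷ X ^ₚ k *ₚ (1ₚ +ₚ X) ^ₚ e) i ≡ + L e (λ a _ → ind a i) (suc k) b
  tail zero    = cong +_ (sym (L-ind-suc-0 e k b))
  tail (suc i) = trans (coeff-basis k e i b) (cong +_ (sym (L-ind-suc e i k b b)))

coeff-sumₚ : ∀ {A : Set} (G : A → Poly) (g : A → ℕ) i → (∀ x → coeff (G x) i ≡ + g x) →
  ∀ xs → coeff (sumₚ (map G xs)) i ≡ + sum (map g xs)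
coeff-sumₚ G g i eq []       = refl
coeff-sumₚ G g i eq (x ∷ xs) = trans (coeff-+ₚ (G x) (sumₚ (map G xs)) i)
  (cong₂ ℤ._+_ (eq x) (coeff-sumₚ G g i eq xs))

⌊2*n/2⌋≡n : ∀ N → ⌊ 2 * N /2⌋ ≡ N
⌊2*n/2⌋≡n N = sym (trans (n≡⌊n+n/2⌋ N) (cong (λ m → ⌊ N + m /2⌋) (sym (+-identityʳ N))))

coeff-γ-expansion : ∀ N (γ : ℕ → ℕ) i → coeff (γ-expansion (2 * N) (λ k → + γ k)) i ≡
  + sum (applyUpTo (λ k → γ k * L (2 * N ∸ 2 * k) (λ a _ → ind a i) k k) (suc N))
coeff-γ-expansion N γ i = trans
  (coeff-sumₚ (λ k → + γ k ·ₚ (X ^ₚ k *ₚ (1ₚ +ₚ X) ^ₚ (2 * N ∸ 2 * k))) g i term (upTo (suc ⌊ 2 * N /2⌋)))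
  (cong +_ (trans (cong (λ m → sum (map g (upTo (suc m)))) (⌊2*n/2⌋≡n N))
    (cong sum (map-upTo g (suc N)))))
  where
  g : ℕ → ℕ
  g k = γ k * L (2 * N ∸ 2 * k) (λ a _ → ind a i) k k
  term : ∀ k → coeff (+ γ k ·ₚ (X ^ₚ k *ₚ (1ₚ +ₚ X) ^ₚ (2 * N ∸ 2 * k))) i ≡ + g k
  term k = trans (coeff-·ₚ (+ γ k) (X ^ₚ k *ₚ (1ₚ +ₚ X) ^ₚ (2 * N ∸ 2 * k)) i)
    (trans (cong (+ γ k ℤ.*_) (coeff-basis k (2 * N ∸ 2 * k) i k)) (sym (ℤ.pos-* (γ k) _)))

-- Symmetry, gamma-positivity and unimodality from the cone

module _ (N : ℕ) (f : Poly) (f≡F : ∀ i → coeff f i ≡ + F N (λ a _ → ind a i)) where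

  cone : Cone N (F N)
  cone = F-Cone N

  coeff-χ : ∀ i j → i + j ≡ 2 * N → coeff f i ≡ + F N (χ i j)
  coeff-χ i j eq = trans (f≡F i) (cong +_ (Cone-cong cone agree))
    where
    agree : ∀ a b → a + b ≡ 2 * N → ind a i ≡ χ i j a b
    agree a b eq′ = ind≡χ a b i j (trans eq′ (sym eq))

  coeff-sym : ∀ i j → i + j ≡ 2 * N → coeff f i ≡ coeff f j
  coeff-sym i j eq = trans (coeff-χ i j eq) (trans
    (cong +_ (trans (Cone-swap cone (χ i j))
      (Cone-cong cone λ a b _ → *-comm (ind b i) (ind a j))))
    (sym (coeff-χ j i (trans (+-comm j i) eq))))

  f-degree : HasDegree f (2 * N)
  f-degree = top , above
    where
    top : coeff f (2 * N) ≢ 0ℤ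
    -- By symmetry the leading coefficient equals the constant one, which is positive.
    top eq with F N (λ a _ → ind a 0) | F-const-pos N | trans (sym (f≡F 0)) (trans (coeff-sym 0 (2 * N) refl) eq)
    ... | suc _ | _ | ()
    above : ∀ i → 2 * N < i → coeff f i ≡ 0ℤ
    above i d<i = trans (f≡F i) (cong +_ (trans
      (Cone-cong cone λ a b eq → ind-< (≤-<-trans (m+n≤o⇒m≤o a (≤-reflexive eq)) d<i))
      (Cone-0 cone)))

  f-symmetric : Symmetric f (2 * N)
  f-symmetric = f-degree , λ i i≤d → coeff-sym i (2 * N ∸ i) (m+[n∸m]≡n i≤d)

  f-γ-positive : γ-Positive f
  f-γ-positive with Cone-γ cone
  ... | γ , eq = 2 * N , f-symmetric , (λ k → + γ k) ,
    (λ i → trans (f≡F i) (trans (cong +_ (eq _)) (sym (coeff-γ-expansion N γ i)))) ,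
    λ k _ → ℤ.+≤+ z≤n

  -- With p + 1 + q = 2N, the condition p ≤ q says that the step from p to p + 1 lies in the left
  -- half.
  coeff-≤ : ∀ p q → p ≤ q → suc p + q ≡ 2 * N → coeff f p ℤ.≤ coeff f (suc p)
  coeff-≤ p q p≤q eq = subst₂ ℤ._≤_
    (sym (coeff-χ p (suc q) (trans (+-suc p q) eq))) (sym (coeff-χ (suc p) q eq))
    (ℤ.+≤+ (Cone-mono cone p≤q))

  f-unimodal : UnimodalWithMode f N
  f-unimodal = 2 * N , f-degree , m≤m+n N _ , rise , fall
    where
    rise : ∀ i → i < N → coeff f i ℤ.≤ coeff f (suc i)
    rise i i<N = coeff-≤ i (2 * N ∸ suc i)
      (m+n≤o⇒m≤o∸n i (≤-trans (+-mono-≤ (<⇒≤ i<N) i<N) (≤-reflexive (cong (λ m → N + m) (sym (+-identityʳ N))))))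
      (m+[n∸m]≡n (≤-trans i<N (m≤m+n N _)))
    fall : ∀ i → N ≤ i → i < 2 * N → coeff f (suc i) ℤ.≤ coeff f i
    -- Reflection in the middle carries i + 1 and i to j and j + 1, where j = 2N - 1 - i lies in the
    -- rising half.
    fall i N≤i i<d = subst₂ ℤ._≤_
      (coeff-sym j (suc i) (m∸n+n≡m i<d))
      (coeff-sym (suc j) i (trans (sym (+-suc j i)) (m∸n+n≡m i<d)))
      (coeff-≤ j i j≤i (trans (sym (+-suc j i)) (m∸n+n≡m i<d)))
      where
      j = 2 * N ∸ suc i
      j≤i : j ≤ i
      j≤i = m≤n+o⇒m∸n≤o (2 * N) (suc i) (≤-trans
        (≤-trans (≤-reflexive (cong (λ m → N + m) (+-identityʳ N))) (+-mono-≤ N≤i N≤i)) (n≤1+n (i + i)))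

-- Insertion of the two largest letters

-- All insertions of k copies of M into w, split by the first letter. Each resulting word is listed
-- once if M does not occur in w.
shuffles : ℕ → ℕ → List ℕ → List (List ℕ)
shuffles M zero    w       = w ∷ []
shuffles M (suc k) []      = map (M ∷_) (shuffles M k [])
shuffles M (suc k) (a ∷ w) = map (M ∷_) (shuffles M k (a ∷ w)) ++ map (a ∷_) (shuffles M (suc k) w)

≢? : ∀ M a → Dec (a ≢ M)
≢? M a = ¬? (a ≟ M)

delete : ℕ → List ℕ → List ℕ
delete M = filter (≢? M)

delete-all< : ∀ {M w} → All (_< M) w → delete M w ≡ w
delete-all< w<M = filter-all (≢? _) (All.map <⇒≢ w<M)

delete-here : ∀ M w → delete M (M ∷ w) ≡ delete M w
delete-here M w = filter-reject (≢? M) λ M≢M → M≢M refl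

delete-shuffle : ∀ {M} k {w} → All (_< M) w → ∀ {σ} → σ ∈ shuffles M k w → delete M σ ≡ w
delete-shuffle zero    w<M (here refl) = delete-all< w<M
delete-shuffle {M} (suc k) [] σ∈ with ∈-map⁻ (M ∷_) σ∈
... | τ , τ∈ , refl = trans (delete-here M τ) (delete-shuffle k [] τ∈)
delete-shuffle {M} (suc k) {a ∷ w} (a<M ∷ w<M) σ∈ with ∈-++⁻ (map (M ∷_) (shuffles M k (a ∷ w))) σ∈
... | inj₁ σ∈ˡ with ∈-map⁻ (M ∷_) σ∈ˡ
...   | τ , τ∈ , refl = trans (delete-here M τ) (delete-shuffle k (a<M ∷ w<M) τ∈)
delete-shuffle {M} (suc k) {a ∷ w} (a<M ∷ w<M) σ∈ | inj₂ σ∈ʳ with ∈-map⁻ (a ∷_) σ∈ʳ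
...   | τ , τ∈ , refl = trans (filter-accept (≢? M) (<⇒≢ a<M)) (cong (a ∷_) (delete-shuffle (suc k) w<M τ∈))

shuffles-unique : ∀ {M} k {w} → All (_< M) w → Unique (shuffles M k w)
shuffles-unique zero    w<M = [] ∷ []
shuffles-unique (suc k) []  = Unique.map⁺ (λ { refl → refl }) (shuffles-unique k [])
shuffles-unique {M} (suc k) {a ∷ w} (a<M ∷ w<M) = Unique.++⁺
  (Unique.map⁺ (λ { refl → refl }) (shuffles-unique k (a<M ∷ w<M)))
  (Unique.map⁺ (λ { refl → refl }) (shuffles-unique (suc k) w<M))
  λ { (σ∈ˡ , σ∈ʳ) → disjoint (∈-map⁻ (M ∷_) σ∈ˡ) (∈-map⁻ (a ∷_) σ∈ʳ) }
  where
  disjoint : ∀ {σ : List ℕ} {A B : List ℕ → Set} →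
    (Σ[ τ ∈ List ℕ ] A τ × σ ≡ M ∷ τ) → (Σ[ τ ∈ List ℕ ] B τ × σ ≡ a ∷ τ) → ⊥
  disjoint (_ , _ , refl) (_ , _ , refl) = <-irrefl refl a<M

shuffle-↭ : ∀ {M} k {w σ} → σ ∈ shuffles M k w → σ ↭ replicate k M ++ w
shuffle-↭ zero (here refl) = ↭-refl
shuffle-↭ {M} (suc k) {[]} σ∈ with ∈-map⁻ (M ∷_) σ∈
... | τ , τ∈ , refl = ↭-prep M (shuffle-↭ k τ∈)
shuffle-↭ {M} (suc k) {a ∷ w} σ∈ with ∈-++⁻ (map (M ∷_) (shuffles M k (a ∷ w))) σ∈
... | inj₁ σ∈ˡ with ∈-map⁻ (M ∷_) σ∈ˡ
...   | τ , τ∈ , refl = ↭-prep M (shuffle-↭ k τ∈)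
shuffle-↭ {M} (suc k) {a ∷ w} σ∈ | inj₂ σ∈ʳ with ∈-map⁻ (a ∷_) σ∈ʳ
...   | τ , τ∈ , refl = ↭-trans (↭-prep a (shuffle-↭ (suc k) τ∈))
  (↭-sym (↭-shift a (replicate (suc k) M) w))

shuffles-here : ∀ {M} k w {σ} → σ ∈ shuffles M k w → M ∷ σ ∈ shuffles M (suc k) w
shuffles-here k []      σ∈ = ∈-map⁺ _ σ∈
shuffles-here k (a ∷ w) σ∈ = ∈-++⁺ˡ (∈-map⁺ _ σ∈)

shuffles-there : ∀ {M} k a {w σ} → σ ∈ shuffles M k w → a ∷ σ ∈ shuffles M k (a ∷ w)
shuffles-there zero    a (here refl) = here refl
shuffles-there (suc k) a σ∈          = ∈-++⁺ʳ _ (∈-map⁺ _ σ∈)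

-- Insertion reaches every word: read from the left, each letter is either a copy of M or the next
-- letter of the rest.
∈-shuffles-delete : ∀ M σ → σ ∈ shuffles M (length (filter (_≟ M) σ)) (delete M σ)
∈-shuffles-delete M []      = here refl
∈-shuffles-delete M (a ∷ σ) with a ≟ M
... | yes refl = subst₂ (λ k w → M ∷ σ ∈ shuffles M k w)
  (cong length (sym (filter-accept (_≟ M) refl))) (sym (delete-here M σ))
  (shuffles-here (length (filter (_≟ M) σ)) _ (∈-shuffles-delete M σ))
... | no a≢M   = subst₂ (λ k w → a ∷ σ ∈ shuffles M k w)
  (cong length (sym (filter-reject (_≟ M) a≢M))) (sym (filter-accept (≢? M) a≢M))
  (shuffles-there (length (filter (_≟ M) σ)) a (∈-shuffles-delete M σ))

-- The map r tells which x an element came from, so the lists `g x` are disjoint for distinct x.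
concatMap-unique : ∀ {A B : Set} (g : A → List B) (r : B → A) {xs} →
  All (λ x → Unique (g x)) xs → All (λ x → ∀ {y} → y ∈ g x → r y ≡ x) xs →
  Unique xs → Unique (concatMap g xs)
concatMap-unique g r []       []       []       = []
concatMap-unique g r {x ∷ xs} (u ∷ us) (h ∷ hs) (x∉ ∷ uxs) =
  Unique.++⁺ u (concatMap-unique g r us hs uxs) disjoint
  where
  disjoint : ∀ {y} → y ∈ g x × y ∈ concatMap g xs → ⊥
  disjoint (y∈ˡ , y∈ʳ) with find (∈-concatMap⁻ g {xs = xs} y∈ʳ)
  ... | x′ , x′∈ , y∈ = All.lookup x∉ x′∈ (trans (sym (h y∈ˡ)) (All.lookup hs x′∈ y∈))

multiset-suc : ∀ n → multiset (suc n) ≡ multiset n ++ suc n ∷ suc n ∷ []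
multiset-suc n = trans
  (cong (λ as → twice (map suc as)) (sym (upTo-∷ʳ n)))
  (trans (cong twice (map-++ suc (upTo n) (n ∷ [])))
    (concatMap-++ (λ a → a ∷ a ∷ []) (letters n) (suc n ∷ [])))

multiset-suc-↭ : ∀ n → multiset (suc n) ↭ suc n ∷ suc n ∷ multiset n
multiset-suc-↭ n = ↭-trans (↭-reflexive (multiset-suc n)) (++-comm (multiset n) (suc n ∷ suc n ∷ []))

multiset-< : ∀ n → All (_< suc n) (multiset n)
multiset-< zero    = []
multiset-< (suc n) = subst (All (_< suc (suc n))) (sym (multiset-suc n))
  (All.++⁺ (All.map m<n⇒m<1+n (multiset-< n)) (≤-refl ∷ ≤-refl ∷ []))

∈-𝒞-< : ∀ n {w} → w ∈ 𝒞 n → All (_< suc n) w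
∈-𝒞-< n w∈ = All-resp-↭ (↭-sym (Equivalence.to (∈-𝒞 n _) w∈)) (multiset-< n)

-- Neither list has repetitions, so it suffices that they have the same members; deleting and
-- inserting the two copies of n + 1 give the two inclusions.
𝒞-suc-↭ : ∀ n → 𝒞 (suc n) ↭ concatMap (shuffles (suc n) 2) (𝒞 n)
𝒞-suc-↭ n = ∼bag⇒↭ (unique∧set⇒bag (𝒞-unique (suc n)) unique (mk⇔ to from))
  where
  M = suc n
  unique : Unique (concatMap (shuffles M 2) (𝒞 n))
  unique = concatMap-unique (shuffles M 2) (delete M)
    (All.tabulate λ w∈ → shuffles-unique 2 (∈-𝒞-< n w∈))
    (All.tabulate λ w∈ → delete-shuffle 2 (∈-𝒞-< n w∈))
    (𝒞-unique n)
  from : ∀ {σ} → σ ∈ concatMap (shuffles M 2) (𝒞 n) → σ ∈ 𝒞 M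
  from {σ} σ∈ with find (∈-concatMap⁻ (shuffles M 2) {xs = 𝒞 n} σ∈)
  ... | w , w∈ , σ∈w = Equivalence.from (∈-𝒞 M σ) (↭-trans (shuffle-↭ 2 σ∈w)
    (↭-trans (↭-prep M (↭-prep M (Equivalence.to (∈-𝒞 n w) w∈))) (↭-sym (multiset-suc-↭ n))))
  to : ∀ {σ} → σ ∈ 𝒞 M → σ ∈ concatMap (shuffles M 2) (𝒞 n)
  to {σ} σ∈ = ∈-concatMap⁺ (shuffles M 2) (lose
    (Equivalence.from (∈-𝒞 n (delete M σ)) deleted)
    (subst (λ k → σ ∈ shuffles M k (delete M σ)) twoM (∈-shuffles-delete M σ)))
    where
    σ↭ : σ ↭ M ∷ M ∷ multiset n
    σ↭ = ↭-trans (Equivalence.to (∈-𝒞 M σ) σ∈) (multiset-suc-↭ n)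
    deleted : delete M σ ↭ multiset n
    deleted = ↭-trans (filter-↭ (≢? M) σ↭) (↭-reflexive
      (trans (delete-here M _) (trans (delete-here M _) (delete-all< (multiset-< n)))))
    twoM : length (filter (_≟ M) σ) ≡ 2
    twoM = trans (↭-length (filter-↭ (_≟ M) σ↭)) (cong length
      (trans (filter-accept (_≟ M) refl) (cong (M ∷_) (trans (filter-accept (_≟ M) refl)
        (cong (M ∷_) (filter-none (_≟ M) (All.map <⇒≢ (multiset-< n))))))))

-- Weak ascents of a ∷ w.  Starting from the letter 0 makes the gap before the
-- first letter a weak ascent, so that des + asc is the length of the word.
asc : ℕ → List ℕ → ℕ
asc a []      = 0
asc a (b ∷ w) = (if does (b <? a) then 0 else 1) + asc b w

weight : Weight → ℕ → List ℕ → ℕ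
weight φ a w = φ (des (a ∷ w)) (asc a w)

-- Multiplies the monomial by x for a descent and by y for a weak ascent.
bump : Bool → Weight → Weight
bump t φ x y = φ ((if t then 1 else 0) + x) ((if t then 0 else 1) + y)

sum-weight-∷ : ∀ φ a b ws →
  sum (map (weight φ a) (map (b ∷_) ws)) ≡ sum (map (weight (bump (does (b <? a)) φ) b) ws)
sum-weight-∷ φ a b ws = cong sum (sym (map-∘ ws))

does-< : ∀ {a b} → a < b → does (a <? b) ≡ true
does-< {a} {b} a<b = dec-true (a <? b) a<b

does-≮ : ∀ {a b} → b ≤ a → does (a <? b) ≡ false
does-≮ {a} {b} b≤a = dec-false (a <? b) (≤⇒≯ b≤a)

-- A copy of the maximal letter M creates a descent in a weak ascent, and creates a
-- weak ascent in a descent or at the end of the word.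
sum-shuffles₁ : ∀ {M} φ a w → a < M → All (_< M) w → let d = des (a ∷ w); u = asc a w in
  sum (map (weight φ a) (shuffles M 1 w)) ≡ (1 + d) * φ d (1 + u) + u * φ (1 + d) u
sum-shuffles₁ {M} φ a [] a<M []
  rewrite does-≮ {M} {a} (<⇒≤ a<M) = sym (+-identityʳ _)
sum-shuffles₁ {M} φ a (b ∷ w) a<M (b<M ∷ w<M)
  rewrite sum-weight-∷ φ a b (shuffles M 1 w)
        | sum-shuffles₁ (bump (does (b <? a)) φ) b w b<M w<M
        | does-≮ {M} {a} (<⇒≤ a<M) | does-< b<M = step (does (b <? a)) (des (b ∷ w)) (asc b w)
  where
  eq₁ : ∀ d u p q → p + ((1 + d) * p + u * q) ≡ (2 + d) * p + u * q
  eq₁ = solve-∀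
  eq₂ : ∀ d u p q → p + ((1 + d) * q + u * p) ≡ (1 + d) * q + (1 + u) * p
  eq₂ = solve-∀
  -- The first summand has M between a and b, a weak ascent followed by a descent. It joins the
  -- first count if the pair a b was a descent and the second if it was a weak ascent.
  step : ∀ t d u → let d′ = (if t then 1 else 0) + d; u′ = (if t then 0 else 1) + u in
    φ (1 + d) (1 + u) + ((1 + d) * bump t φ d (1 + u) + u * bump t φ (1 + d) u) ≡
    (1 + d′) * φ d′ (1 + u′) + u′ * φ (1 + d′) u′
  step true  d u = eq₁ d u (φ (1 + d) (1 + u)) _
  step false d u = eq₂ d u (φ (1 + d) (1 + u)) _

-- Two copies placed in the d + 1 gaps that create no descent, repetition allowed, give
-- `tri (2 + d)`; in two distinct weak ascents, `tri u`. One copy of each kind gives (1 + d) u, and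
-- both copies in the same weak ascent, which add one descent and one weak ascent, give u more.
sum-shuffles₂ : ∀ {M} φ a w → a < M → All (_< M) w → let d = des (a ∷ w); u = asc a w in
  sum (map (weight φ a) (shuffles M 2 w)) ≡
  tri (2 + d) * φ d (2 + u) + (2 + d) * u * φ (1 + d) (1 + u) + tri u * φ (2 + d) u
sum-shuffles₂ {M} φ a [] a<M []
  rewrite does-≮ {M} {a} (<⇒≤ a<M) | does-≮ {M} {M} ≤-refl = sym (trans (+-identityʳ _) (+-identityʳ _))
sum-shuffles₂ {M} φ a (b ∷ w) a<M (b<M ∷ w<M) = begin
  sum (map (weight φ a) (map (M ∷_) (shuffles M 1 (b ∷ w)) ++ map (b ∷_) (shuffles M 2 w)))
    ≡⟨ trans (cong sum (map-++ (weight φ a) (map (M ∷_) (shuffles M 1 (b ∷ w))) _))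
         (sum-++ (map (weight φ a) (map (M ∷_) (shuffles M 1 (b ∷ w)))) _) ⟩
  sum (map (weight φ a) (map (M ∷_) (shuffles M 1 (b ∷ w)))) +
  sum (map (weight φ a) (map (b ∷_) (shuffles M 2 w)))
    ≡⟨ cong₂ _+_ first (trans (sum-weight-∷ φ a b (shuffles M 2 w))
         (sum-shuffles₂ (bump (does (b <? a)) φ) b w b<M w<M)) ⟩
  _
    ≡⟨ step (does (b <? a)) (des (b ∷ w)) (asc b w) ⟩
  _ ∎
  where
  open ≡-Reasoning
  -- One copy of M comes directly after a; the other follows at once or stands after b.
  first : let d = des (b ∷ w); u = asc b w in
    sum (map (weight φ a) (map (M ∷_) (shuffles M 1 (b ∷ w)))) ≡
    φ (1 + d) (2 + u) + ((1 + d) * φ (1 + d) (2 + u) + u * φ (2 + d) (1 + u))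
  first rewrite sum-weight-∷ φ a M (shuffles M 1 (b ∷ w))
              | sum-weight-∷ (bump (does (M <? a)) φ) M b (shuffles M 1 w)
              | sum-shuffles₁ (bump (does (b <? M)) (bump (does (M <? a)) φ)) b w b<M w<M
              | does-≮ {M} {a} (<⇒≤ a<M) | does-≮ {M} {M} ≤-refl | does-< b<M = refl
  eq₁ : ∀ d u s t p q r →
    p + ((1 + d) * p + u * q) + (s * p + (2 + d) * u * q + t * r) ≡
    (2 + d + s) * p + (3 + d) * u * q + t * r
  eq₁ = solve-∀
  eq₂ : ∀ d u s t p q r →
    p + ((1 + d) * p + u * q) + (s * r + (2 + d) * u * p + t * q) ≡
    s * r + (2 + d) * (1 + u) * p + (u + t) * q
  eq₂ = solve-∀
  step : ∀ t d u → let d′ = (if t then 1 else 0) + d; u′ = (if t then 0 else 1) + u in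
    φ (1 + d) (2 + u) + ((1 + d) * φ (1 + d) (2 + u) + u * φ (2 + d) (1 + u)) +
    (tri (2 + d) * bump t φ d (2 + u) + (2 + d) * u * bump t φ (1 + d) (1 + u) + tri u * bump t φ (2 + d) u) ≡
    tri (2 + d′) * φ d′ (2 + u′) + (2 + d′) * u′ * φ (1 + d′) (1 + u′) + tri u′ * φ (2 + d′) u′
  step true  d u = eq₁ d u (tri (2 + d)) (tri u) (φ (1 + d) (2 + u)) _ _
  step false d u = eq₂ d u (tri (2 + d)) (tri u) (φ (1 + d) (2 + u)) (φ (2 + d) (1 + u)) _

-- The truncations of `pred` at u = 0 and u = 1 occur only in terms with coefficient 0, hence the
-- case split.
T-shift : ∀ φ d u → T (shift φ) (2 + d) u ≡
  tri (2 + d) * φ (2 + d) (2 + u) + (2 + d) * u * φ (3 + d) (1 + u) + tri u * φ (4 + d) u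
T-shift φ d zero          = cong (λ x → tri (2 + d) * φ (2 + d) 2 + x + 0)
  (trans (cong (_* φ (3 + d) 2) (*-zeroʳ d)) (sym (cong (_* φ (3 + d) 1) (*-zeroʳ d))))
T-shift φ d (suc zero)    = refl
T-shift φ d (suc (suc u)) = refl

-- The action on weights of the polynomial Σ x^(2 + des σ) y^(asc σ).
S : ℕ → Functional
S n φ = sum (map (weight (λ x y → φ (2 + x) y) 0) (𝒞 n))

-- The recurrence and the coefficients of the descent polynomial

sum-concatMap : ∀ {A B : Set} (f : B → ℕ) (g : A → List B) xs →
  sum (map f (concatMap g xs)) ≡ sum (map (λ x → sum (map f (g x))) xs)
sum-concatMap f g []       = refl
sum-concatMap f g (x ∷ xs) = trans (cong sum (map-++ f (g x) (concatMap g xs)))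
  (trans (sum-++ (map f (g x)) _) (cong (_+_ (sum (map f (g x)))) (sum-concatMap f g xs)))

-- `S` carries the factor x²y² already, so the insertion count is `T` at x^(2 + d) y^u, and `shift`
-- restores that factor for the next stage.
S-suc : ∀ n φ → S (suc n) φ ≡ S n (T (shift φ))
S-suc n φ = begin
  sum (map f (𝒞 (suc n)))
    ≡⟨ sum-↭ (map⁺ f (𝒞-suc-↭ n)) ⟩
  sum (map f (concatMap (shuffles (suc n) 2) (𝒞 n)))
    ≡⟨ sum-concatMap f (shuffles (suc n) 2) (𝒞 n) ⟩
  sum (map (λ w → sum (map f (shuffles (suc n) 2 w))) (𝒞 n))
    ≡⟨ cong sum (map-cong-local (All.tabulate λ {w} w∈ →
         trans (sum-shuffles₂ (λ x y → φ (2 + x) y) 0 w (s≤s z≤n) (∈-𝒞-< n w∈))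
           (sym (T-shift φ (des (0 ∷ w)) (asc 0 w))))) ⟩
  S n (T (shift φ)) ∎
  where
  open ≡-Reasoning
  f = weight (λ x y → φ (2 + x) y) 0

S≡F : ∀ N φ → S (suc N) φ ≡ F N (shift φ)
-- The only word of `𝒞 1` is 1 1, with no descent and, after the letter 0, two weak ascents.
S≡F zero    φ = +-identityʳ (φ 2 2)
S≡F (suc N) φ = trans (S-suc (suc N) φ) (S≡F N (T (shift φ)))

des-0∷ : ∀ w → des (0 ∷ w) ≡ des w
des-0∷ []      = refl
des-0∷ (b ∷ w) = refl

coeff-P : ∀ N i → coeff (P (suc N)) i ≡ + F N (λ a _ → ind a i)
coeff-P N i = trans
  (coeff-sumₚ (λ σ → X ^ₚ des σ) (λ σ → ind (des σ) i) i (λ σ → coeff-X^ (des σ) i) (𝒞 (suc N)))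
  (cong +_ (trans
    (cong sum (map-cong (λ σ → cong (λ d → ind d i) (sym (des-0∷ σ))) (𝒞 (suc N))))
    -- The index 2 + i offsets the factor x² in `S`.
    (S≡F N (λ a _ → ind a (2 + i)))))

proposition2 : (n : ℕ) → 1 ≤ n →
    Symmetric (P n) (2 * n ∸ 2) × γ-Positive (P n) × UnimodalWithMode (P n) (n ∸ 1)
proposition2 (suc N) _ =
  subst (Symmetric (P (suc N))) (sym (cong (_∸ 2) (*-suc 2 N))) (f-symmetric N (P (suc N)) (coeff-P N)) ,
  f-γ-positive N (P (suc N)) (coeff-P N) ,
  f-unimodal N (P (suc N)) (coeff-P N)
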